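{- In the type system for the impure calculus, if $\Gamma\bullet f:\mathsf o^k\tilde T\vdash P:w$ is derivable, then $P$ terminates, i.e. there is no infinite sequence of processes $(P_i)_{i\ge0}$ with $P_0=P$ and $P_i\longrightarrow P_{i+1}$ for all $i$.
   Context: **Processes (polyadic).** Fix an infinite set of names. Values: $v ::= \star\mid a$ ($a$ a name). Tuples of values and names are written $\tilde v,\tilde x$ (length $\ge 1$; names in $\tilde x$ pairwise distinct). Processes: $P ::= \mathbf 0 \mid P_1|P_2 \mid \overline a\langle\tilde v\rangle \mid (\nu a)P \mid a(\tilde x).P \mid\, !a(\tilde x).P$. $(\nu a)P$ binds $a$; $a(\tilde x).P$ and $!a(\tilde x).P$ bind $\tilde x$ in $P$. $\mathrm{fn}(P)$ is the set of free names. Processes are implicitly assumed written so that all bound names are pairwise distinct and different from the free names, with implicit $\alpha$-renaming whenever needed. **Types.** $T ::= \sharp^{k}\tilde T \mid \mathsf i^{k}\tilde T \mid \mathsf o^{k}\tilde T \mid \mathbb U$, $k\in\mathbb N$. Subtyping $\le$, extended componentwise to tuples of equal length, is the least reflexive and transitive relation such that: $\sharp^k\tilde T\le \mathsf i^k\tilde T$; $\sharp^k\tilde T\le\mathsf o^k\tilde T$; if $\tilde T\le \tilde S$ and $k_1\le k_2$ then $\mathsf i^{k_2}\tilde T\le\mathsf i^{k_1}\tilde S$; if $\tilde T\le \tilde S$ and $k_1\le k_2$ then $\mathsf o^{k_1}\tilde S\le\mathsf o^{k_2}\tilde T$. **Typing values.** $\Gamma$ is a partial map from names to types; $\Gamma,a:T$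 is its extension, defined only when $a\notin\mathrm{dom}(\Gamma)$. $\Gamma\vdash\star:\mathbb U$; $\Gamma\vdash a:T$ if $\Gamma(a)=T$; if $\Gamma\vdash a:T$ and $T\le U$ then $\Gamma\vdash a:U$; tuples componentwise. **Typing processes in the impure calculus.** Judgements are $\Gamma\bullet f:\mathsf o^k\tilde T\vdash P:w$ with $w\in\mathbb N$, where $f\notin\mathrm{dom}(\Gamma)$ is an "isolated" name. The notation $\Gamma\bullet -$ stands for $\Gamma\bullet d:\mathsf o^k\tilde T$ for some dummy name $d$ not used in the process being typed. Rules: - $\Gamma\bullet f:\mathsf o^k\tilde T\vdash\mathbf 0:0$; - if $\Gamma,\tilde x:\tilde T\bullet -\vdash P:w$ and $k\ge w$, then $\Gamma\bullet f:\mathsf o^k\tilde T\vdash\,!f(\tilde x).P:0$; - if $\Gamma,f:\mathsf o^k\tilde T\vdash a:\mathsf o^n\tilde U$ and $\Gamma,f:\mathsf o^k\tilde T\vdash\tilde v:\tilde U$, then $\Gamma\bullet f:\mathsf o^k\tilde T\vdash\overline a\langle\tilde v\rangle:n$; - if $\Gamma\vdash c:\mathsf i^n\tilde T$, $\Gamma,\tilde x:\tilde T,f:\mathsf o^k\tilde U\bullet -\vdash P:w$ and $n>w$, then $\Gamma\bullet f:\mathsf o^k\tilde U\vdash c(\tilde x).P:0$; - if $\Gamma\vdash c:\mathsf i^n\tilde T$, $\Gamma,\tilde x:\tilde T,f:\mathsf o^k\tilde U\bullet -\vdash P:w$ and $n>w$, then $\Gamma\bullet f:\mathsf o^k\tilde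 U\vdash\,!c(\tilde x).P:0$; - if $\Gamma\bullet f:\mathsf o^k\tilde T\vdash P_i:w_i$ for $i=1,2$, then $\Gamma\bullet f:\mathsf o^k\tilde T\vdash P_1|P_2:\max(w_1,w_2)$; - if $\Gamma,g:\mathsf o^k\tilde T\bullet f:\mathsf o^n\tilde U\vdash P:w$, then $\Gamma\bullet g:\mathsf o^k\tilde T\vdash(\nu f)P:w$ (functional restriction); - if $\Gamma,c:\sharp^n\tilde T\bullet f:\mathsf o^k\tilde U\vdash P:w$, then $\Gamma\bullet f:\mathsf o^k\tilde U\vdash(\nu c)P:w$ (imperative restriction). **Structural congruence** $\equiv$ is the smallest equivalence relation that is a congruence, contains $\alpha$-conversion and satisfies: $P|(Q|R)\equiv(P|Q)|R$, $P|Q\equiv Q|P$, $P|\mathbf 0\equiv P$, $(\nu a)\mathbf 0\equiv\mathbf 0$, $(\nu a)(\nu b)P\equiv(\nu b)(\nu a)P$, and $(\nu a)(P|Q)\equiv P|(\nu a)Q$ if $a\notin\mathrm{fn}(P)$. **Reduction** $\longrightarrow$: $a(\tilde x).P\,|\,\overline a\langle\tilde v\rangle\longrightarrow P[\tilde v/\tilde x]$; $!a(\tilde x).P\,|\,\overline a\langle\tilde v\rangle\longrightarrow\,!a(\tilde x).P\,|\,P[\tilde v/\tilde x]$ (simultaneous capture-avoiding substitution; $\tilde v$ and $\tilde x$ of the same length); closure under $\cdot|Q$ and $(\nu a)\cdot$; and if $Q\equiv P\longrightarrow P'\equiv Q'$ then $Q\longrightarrow Q'$. -}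

module Defs where

open import Data.Fin using (Fin; zero; suc; lift; splitAt)
open import Data.Maybe as Maybe using (Maybe; just; nothing)
open import Data.Nat using (ℕ; zero; suc; _+_; _≤_; _>_; _≥_; _⊔_)
open import Data.Product using (∃; _×_)
open import Data.Sum using ([_,_]′)
open import Data.Vec using (Vec; _∷_; _++_; lookup; map; _[_]≔_)
open import Data.Vec.Relation.Binary.Pointwise.Inductive using (Pointwise)
open import Function using (_∘_)
open import Relation.Binary.PropositionalEquality using (_≡_)
open import Relation.Nullary using (¬_)

-- Names are well-scoped de Bruijn indices: `Proc n` contains the processes,
-- up to α-conversion, whose free names are among n given ones.
-- The infinite supply of names is accounted for by letting n be arbitrary.

data Val (n : ℕ) : Set where
  ⋆    : Val n
  name : Fin n → Val n

infixr 5 _∣_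

-- Tuples in processes have length suc m, hence at least 1.
-- A prefix with parameters x₀ , … , xₘ binds xᵢ as the index i.
data Proc (n : ℕ) : Set where
  𝟎   : Proc n
  _∣_ : Proc n → Proc n → Proc n
  out : ∀ {m} → Fin n → Vec (Val n) (suc m) → Proc n
  ν   : Proc (suc n) → Proc n
  inp : ∀ {m} → Fin n → Proc (suc m + n) → Proc n
  rep : ∀ {m} → Fin n → Proc (suc m + n) → Proc n

renameVal : ∀ {n n′} → (Fin n → Fin n′) → Val n → Val n′
renameVal ρ ⋆        = ⋆
renameVal ρ (name a) = name (ρ a)

rename : ∀ {n n′} → (Fin n → Fin n′) → Proc n → Proc n′
rename ρ 𝟎               = 𝟎
rename ρ (P ∣ Q)         = rename ρ P ∣ rename ρ Q
rename ρ (out a vs)      = out (ρ a) (map (renameVal ρ) vs)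
rename ρ (ν P)           = ν (rename (lift 1 ρ) P)
rename ρ (inp {m} a P)   = inp (ρ a) (rename (lift (suc m) ρ) P)
rename ρ (rep {m} a P)   = rep (ρ a) (rename (lift (suc m) ρ) P)

-- A process of the form `weaken P` is one in which the name zero is not free.
weaken : ∀ {n} → Proc n → Proc (suc n)
weaken = rename suc

swap : ∀ {n} → Fin (2 + n) → Fin (2 + n)
swap zero          = suc zero
swap (suc zero)    = zero
swap (suc (suc a)) = suc (suc a)

Sub : ℕ → ℕ → Set
Sub n n′ = Fin n → Val n′

extend : ∀ {n n′} → Sub n n′ → Sub (suc n) (suc n′)
extend σ zero    = name zero
extend σ (suc a) = renameVal suc (σ a)

liftSub : ∀ k {n n′} → Sub n n′ → Sub (k + n) (k + n′)
liftSub zero    σ = σ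
liftSub (suc k) σ = extend (liftSub k σ)

substVal : ∀ {n n′} → Sub n n′ → Val n → Val n′
substVal σ ⋆        = ⋆
substVal σ (name a) = σ a

asName : ∀ {n} → Val n → Maybe (Fin n)
asName ⋆        = nothing
asName (name a) = just a

-- Substitution is partial: it yields no process when ⋆ would end up as the
-- subject of a prefix or of an output.
subst : ∀ {n n′} → Sub n n′ → Proc n → Maybe (Proc n′)
subst σ 𝟎             = just 𝟎
subst σ (P ∣ Q)       = Maybe.zipWith _∣_ (subst σ P) (subst σ Q)
subst σ (out a vs)    = Maybe.map (λ b → out b (map (substVal σ) vs)) (asName (σ a))
subst σ (ν P)         = Maybe.map ν (subst (liftSub 1 σ) P)
subst σ (inp {m} a P) = Maybe.zipWith inp (asName (σ a)) (subst (liftSub (suc m) σ) P)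
subst σ (rep {m} a P) = Maybe.zipWith rep (asName (σ a)) (subst (liftSub (suc m) σ) P)

_[_] : ∀ {n m} → Proc (m + n) → Vec (Val n) m → Maybe (Proc n)
_[_] {m = m} P vs = subst ([ lookup vs , name ]′ ∘ splitAt m) P

infix 4 _≋_ _⟶_

-- Structural congruence; α-conversion is built into the representation.
data _≋_ {n} : Proc n → Proc n → Set where
  ≋-refl   : ∀ {P} → P ≋ P
  ≋-sym    : ∀ {P Q} → P ≋ Q → Q ≋ P
  ≋-trans  : ∀ {P Q R} → P ≋ Q → Q ≋ R → P ≋ R
  ∣-cong   : ∀ {P P′ Q Q′} → P ≋ P′ → Q ≋ Q′ → P ∣ Q ≋ P′ ∣ Q′
  ν-cong   : ∀ {P P′} → P ≋ P′ → ν P ≋ ν P′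
  inp-cong : ∀ {m a} {P P′ : Proc (suc m + n)} → P ≋ P′ → inp {m = m} a P ≋ inp a P′
  rep-cong : ∀ {m a} {P P′ : Proc (suc m + n)} → P ≋ P′ → rep {m = m} a P ≋ rep a P′
  ∣-assoc  : ∀ {P Q R} → P ∣ (Q ∣ R) ≋ (P ∣ Q) ∣ R
  ∣-comm   : ∀ {P Q} → P ∣ Q ≋ Q ∣ P
  ∣-unit   : ∀ {P} → P ∣ 𝟎 ≋ P
  ν-𝟎      : ν 𝟎 ≋ 𝟎
  ν-swap   : ∀ {P} → ν (ν P) ≋ ν (ν (rename swap P))
  ν-extr   : ∀ {P Q} → ν (weaken P ∣ Q) ≋ P ∣ ν Q

data _⟶_ {n} : Proc n → Proc n → Set where
  comm   : ∀ {m a} {P : Proc (suc m + n)} {vs : Vec (Val n) (suc m)} {P′} →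
           P [ vs ] ≡ just P′ → inp a P ∣ out a vs ⟶ P′
  call   : ∀ {m a} {P : Proc (suc m + n)} {vs : Vec (Val n) (suc m)} {P′} →
           P [ vs ] ≡ just P′ → rep {m = m} a P ∣ out a vs ⟶ rep {m = m} a P ∣ P′
  par    : ∀ {P P′ Q} → P ⟶ P′ → P ∣ Q ⟶ P′ ∣ Q
  res    : ∀ {P P′} → P ⟶ P′ → ν P ⟶ ν P′
  struct : ∀ {P P′ Q Q′} → Q ≋ P → P ⟶ P′ → P′ ≋ Q′ → Q ⟶ Q′

Terminates : ∀ {n} → Proc n → Set
Terminates {n} P =
  ¬ ∃ λ (Ps : ℕ → Proc n) → Ps 0 ≡ P × (∀ i → Ps i ⟶ Ps (suc i))

data Ty : Set where
  ♯ 𝕚 𝕠 : ∀ {m} → ℕ → Vec Ty m → Ty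
  𝕌     : Ty

infix 4 _≼_

data _≼_ : Ty → Ty → Set where
  ≼-refl  : ∀ {T} → T ≼ T
  ≼-trans : ∀ {T U V} → T ≼ U → U ≼ V → T ≼ V
  ♯≼𝕚     : ∀ {m k} {Ts : Vec Ty m} → ♯ k Ts ≼ 𝕚 k Ts
  ♯≼𝕠     : ∀ {m k} {Ts : Vec Ty m} → ♯ k Ts ≼ 𝕠 k Ts
  𝕚≼𝕚     : ∀ {m k₁ k₂} {Ts Ss : Vec Ty m} →
            Pointwise _≼_ Ts Ss → k₁ ≤ k₂ → 𝕚 k₂ Ts ≼ 𝕚 k₁ Ss
  𝕠≼𝕠     : ∀ {m k₁ k₂} {Ts Ss : Vec Ty m} →
            Pointwise _≼_ Ts Ss → k₁ ≤ k₂ → 𝕠 k₁ Ss ≼ 𝕠 k₂ Ts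

-- A partial map from names to types.
Ctx : ℕ → Set
Ctx n = Vec (Maybe Ty) n

_∉dom_ : ∀ {n} → Fin n → Ctx n → Set
a ∉dom Γ = lookup Γ a ≡ nothing

-- Extension with a name already in scope; used only when a ∉dom Γ.
infixl 6 _,_∶_
_,_∶_ : ∀ {n} → Ctx n → Fin n → Ty → Ctx n
Γ , a ∶ T = Γ [ a ]≔ just T

infixl 6 _,*_
_,*_ : ∀ {n m} → Ctx n → Vec Ty m → Ctx (m + n)
Γ ,* Ts = map just Ts ++ Γ

infix 4 _⊢ᵛ_∶_
data _⊢ᵛ_∶_ {n} (Γ : Ctx n) : Val n → Ty → Set where
  unit : Γ ⊢ᵛ ⋆ ∶ 𝕌
  var  : ∀ {a T} → lookup Γ a ≡ just T → Γ ⊢ᵛ name a ∶ T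
  sub  : ∀ {a T U} → Γ ⊢ᵛ name a ∶ T → T ≼ U → Γ ⊢ᵛ name a ∶ U

infix 4 _•_∶𝕠^_⟨_⟩⊢_∶_ _•-⊢_∶_

-- Γ • f ∶𝕠^ k ⟨ Ts ⟩⊢ P ∶ w  is meant for f ∉dom Γ.  Read from conclusion to
-- premises, the rules preserve this condition.
data _•_∶𝕠^_⟨_⟩⊢_∶_ {n} (Γ : Ctx n) (f : Fin n) (k : ℕ) :
       ∀ {l} → Vec Ty l → Proc n → ℕ → Set

-- Γ •-⊢ P ∶ w : the isolated name is a dummy, taken outside the scope of Γ and P.
data _•-⊢_∶_ {n} (Γ : Ctx n) (P : Proc n) (w : ℕ) : Set

data _•_∶𝕠^_⟨_⟩⊢_∶_ {n} Γ f k where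

  nil     : ∀ {l} {Ts : Vec Ty l} →
            Γ • f ∶𝕠^ k ⟨ Ts ⟩⊢ 𝟎 ∶ 0

  rep-fun : ∀ {m} {Ts : Vec Ty (suc m)} {P : Proc (suc m + n)} {w} →
            Γ ,* Ts •-⊢ P ∶ w → k ≥ w →
            Γ • f ∶𝕠^ k ⟨ Ts ⟩⊢ rep f P ∶ 0

  out     : ∀ {l} {Ts : Vec Ty l} {m a i} {Us : Vec Ty (suc m)} {vs : Vec (Val n) (suc m)} →
            Γ , f ∶ 𝕠 k Ts ⊢ᵛ name a ∶ 𝕠 i Us →
            Pointwise (Γ , f ∶ 𝕠 k Ts ⊢ᵛ_∶_) vs Us →
            Γ • f ∶𝕠^ k ⟨ Ts ⟩⊢ out a vs ∶ i

  inp-imp : ∀ {l} {Ts : Vec Ty l} {m c i} {Us : Vec Ty (suc m)} {P : Proc (suc m + n)} {w} →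
            Γ ⊢ᵛ name c ∶ 𝕚 i Us →
            (Γ , f ∶ 𝕠 k Ts) ,* Us •-⊢ P ∶ w → i > w →
            Γ • f ∶𝕠^ k ⟨ Ts ⟩⊢ inp c P ∶ 0

  rep-imp : ∀ {l} {Ts : Vec Ty l} {m c i} {Us : Vec Ty (suc m)} {P : Proc (suc m + n)} {w} →
            Γ ⊢ᵛ name c ∶ 𝕚 i Us →
            (Γ , f ∶ 𝕠 k Ts) ,* Us •-⊢ P ∶ w → i > w →
            Γ • f ∶𝕠^ k ⟨ Ts ⟩⊢ rep c P ∶ 0

  par     : ∀ {l} {Ts : Vec Ty l} {P₁ P₂ w₁ w₂} →
            Γ • f ∶𝕠^ k ⟨ Ts ⟩⊢ P₁ ∶ w₁ →
            Γ • f ∶𝕠^ k ⟨ Ts ⟩⊢ P₂ ∶ w₂ →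
            Γ • f ∶𝕠^ k ⟨ Ts ⟩⊢ P₁ ∣ P₂ ∶ w₁ ⊔ w₂

  res-fun : ∀ {l} {Ts : Vec Ty l} {m i} {Us : Vec Ty m} {P : Proc (suc n)} {w} →
            nothing ∷ (Γ , f ∶ 𝕠 k Ts) • zero ∶𝕠^ i ⟨ Us ⟩⊢ P ∶ w →
            Γ • f ∶𝕠^ k ⟨ Ts ⟩⊢ ν P ∶ w

  res-imp : ∀ {l} {Ts : Vec Ty l} {m i} {Us : Vec Ty m} {P : Proc (suc n)} {w} →
            just (♯ i Us) ∷ Γ • suc f ∶𝕠^ k ⟨ Ts ⟩⊢ P ∶ w →
            Γ • f ∶𝕠^ k ⟨ Ts ⟩⊢ ν P ∶ w

data _•-⊢_∶_ {n} Γ P w where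
  dummy : ∀ {m k} {Ts : Vec Ty m} →
          nothing ∷ Γ • zero ∶𝕠^ k ⟨ Ts ⟩⊢ weaken P ∶ w →
          Γ •-⊢ P ∶ w

{-# OPTIONS --safe #-}

-- Every name gets a meaning: a tuple of accepted parameter types together with
-- a function computing, from the meanings of the arguments, the cost of an
-- output on it.  A cost counts outputs by level and costs are compared
-- lexicographically, highest level first.  A process has cost c under ρ when
-- its top-level outputs cost at most c in total and every input, top-level or
-- not, answers each call by a body strictly cheaper than that call.  This
-- property survives ≋, and each communication lowers the cost.
--
-- Typability only serves to find meanings.  An output on an imperative name of
-- level k costs one at level k, more than the whole of a continuation of
-- weight below k.  A functional name of level k costs one at level k plus the
-- cost of its bodies; this is no circular definition because these bodies do
-- not mention that name.
module Submission where

open import Defs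
open import Data.Empty using (⊥)
open import Data.Fin using (Fin; zero; suc; lift; splitAt)
open import Data.Maybe using (Maybe; just; nothing)
open import Data.Nat using (ℕ; zero; suc; _+_; _≤_; _<_; s≤s; z≤n)
open import Data.Nat.Induction using (<-wellFounded)
open import Data.Nat.Properties
open import Data.Product using (Σ; ∃; _×_; _,_; proj₁; proj₂; map₂)
open import Data.Sum using (_⊎_; inj₁; inj₂; [_,_]′)
open import Data.Unit using (⊤; tt)
open import Data.Vec using (Vec; []; _∷_; _++_; lookup; map)
open import Data.Vec.Properties using (map-cong; map-∘)
open import Data.Vec.Relation.Binary.Pointwise.Inductive as Pointwise using (Pointwise; []; _∷_)
open import Data.Vec.Relation.Unary.All using (All; []; _∷_)
open import Function using (_∘_)
open import Function.Bundles using (_⇔_; mk⇔; Equivalence)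
open import Induction.WellFounded using (Acc; acc; WellFounded)
open import Relation.Binary.PropositionalEquality as ≡
  using (_≡_; refl; sym; trans; cong; cong₂)
open import Relation.Nullary using (contradiction)

open Equivalence using (to; from)

-- Costs

Cost : Set
Cost = ℕ → ℕ

infix 4 _≤̇_ _≺_ _≺[_]_
infixl 6 _+̇_

_+̇_ : Cost → Cost → Cost
(c +̇ d) j = c j + d j

_≤̇_ : Cost → Cost → Set
c ≤̇ d = ∀ j → c j ≤ d j

-- Above `k` only `≤` is asked, so `k` need not be the highest level of difference, and one witness
-- survives enlarging the right-hand side or adding a common cost. Not well-founded on unbounded
-- costs.
_≺_ : Cost → Cost → Set
c ≺ d = ∃ λ k → c k < d k × ∀ j → k < j → c j ≤ d j

Bounded : ℕ → Cost → Set
Bounded w c = ∀ j → w < j → c j ≡ 0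

≺-≤̇-trans : ∀ {c d e} → c ≺ d → d ≤̇ e → c ≺ e
≺-≤̇-trans (k , lt , le) d≤e =
  k , <-≤-trans lt (d≤e k) , λ j k<j → ≤-trans (le j k<j) (d≤e j)

+̇-monoˡ-≺ : ∀ {c d} e → c ≺ d → c +̇ e ≺ d +̇ e
+̇-monoˡ-≺ e (k , lt , le) =
  k , +-monoˡ-< (e k) lt , λ j k<j → +-monoˡ-≤ (e j) (le j k<j)

+̇-monoʳ-≺ : ∀ {c d} e → c ≺ d → e +̇ c ≺ e +̇ d
+̇-monoʳ-≺ e (k , lt , le) =
  k , +-monoʳ-< (e k) lt , λ j k<j → +-monoʳ-≤ (e j) (le j k<j)

≺-bounded : ∀ {w c d} → c ≺ d → Bounded w d → Bounded w c
≺-bounded {w} {c} {d} (k , lt , le) b j w<j with ≤-<-connex k w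
... | inj₁ k≤w = n≤0⇒n≡0 (≤-trans (le j (≤-<-trans k≤w w<j)) (≤-reflexive (b j w<j)))
... | inj₂ w<k = contradiction (≤-trans lt (≤-reflexive (b k w<k))) n≮0

-- However large `c` is at levels up to `w`, it vanishes from `k` upwards, so a single unit at level
-- `k` outweighs it.
bounded-≺ : ∀ {w c d k} → Bounded w c → w < k → 1 ≤ d k → c ≺ d
bounded-≺ {k = k} b w<k 1≤dk =
  k , ≤-trans (s≤s (≤-reflexive (b k w<k))) 1≤dk ,
  λ j k<j → ≤-trans (≤-reflexive (b j (<-trans w<k k<j))) z≤n

bounded-mono : ∀ {v w c} → v ≤ w → Bounded v c → Bounded w c
bounded-mono v≤w b j w<j = b j (≤-<-trans v≤w w<j)

bounded-+̇ : ∀ {w c d} → Bounded w c → Bounded w d → Bounded w (c +̇ d)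
bounded-+̇ b b′ j w<j = cong₂ _+_ (b j w<j) (b′ j w<j)

-- Comparison of the levels below N only, which is well-founded on all costs.
_≺[_]_ : Cost → ℕ → Cost → Set
c ≺[ zero  ] d = ⊥
c ≺[ suc N ] d = c N < d N ⊎ (c N ≤ d N × c ≺[ N ] d)

≺[]-wellFounded : ∀ N → WellFounded _≺[ N ]_
≺[]-wellFounded zero    c = acc λ ()
≺[]-wellFounded (suc N) c = acc (below (<-wellFounded (c N)) (≺[]-wellFounded N c) ≤-refl)
  where
  -- `v` only bounds the top entry: the second case of the order may lower that entry too, so
  -- equality would not persist along the inner induction.
  below : ∀ {v c} → Acc _<_ v → Acc _≺[ N ]_ c → c N ≤ v →
          ∀ {d} → d ≺[ suc N ] c → Acc _≺[ suc N ]_ d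
  below (acc r) _ c≤v {d} (inj₁ lt) =
    acc (below (r (<-≤-trans lt c≤v)) (≺[]-wellFounded N d) ≤-refl)
  below rs (acc s) c≤v (inj₂ (le , lt)) = acc (below rs (s lt) (≤-trans le c≤v))

≺⇒≺[] : ∀ {w c d} → Bounded w d → c ≺ d → c ≺[ suc w ] d
≺⇒≺[] {w} {c} {d} b (k , lt , le) with ≤-<-connex k w
... | inj₂ w<k = contradiction (≤-trans lt (≤-reflexive (b k w<k))) n≮0
... | inj₁ k≤w = below (suc w) (s≤s k≤w)
  where
  below : ∀ N → k < N → c ≺[ N ] d
  below (suc N) (s≤s k≤N) with m≤n⇒m<n∨m≡n k≤N
  ... | inj₁ k<N  = inj₂ (le N k<N , below N k<N)
  ... | inj₂ refl = inj₁ lt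

δ : ℕ → Cost
δ zero    zero    = 1
δ zero    (suc j) = 0
δ (suc k) zero    = 0
δ (suc k) (suc j) = δ k j

δ-diag : ∀ k → δ k k ≡ 1
δ-diag zero    = refl
δ-diag (suc k) = δ-diag k

δ-bounded : ∀ k → Bounded k (δ k)
δ-bounded zero    (suc j) _         = refl
δ-bounded (suc k) (suc j) (s≤s k<j) = δ-bounded k j k<j

-- The price of an output on a channel of level `k`. The lower bound pays for continuations of
-- smaller weight; the upper bound keeps the output within the weight given by its type.
Fee : ℕ → Set
Fee k = Σ Cost λ c → 1 ≤ c k × Bounded k c

δ+ : ∀ k → Σ Cost (Bounded k) → Fee k
δ+ k (c , b) =
  δ k +̇ c , ≤-trans (≤-reflexive (sym (δ-diag k))) (m≤m+n _ _) , bounded-+̇ (δ-bounded k) b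

≺-δ+ : ∀ {k c} d → c ≤̇ proj₁ d → c ≺ proj₁ (δ+ k d)
≺-δ+ {k} d c≤d =
  k , ≤-trans (s≤s (c≤d k)) (+-monoˡ-≤ _ (≤-reflexive (sym (δ-diag k)))) ,
  λ j _ → ≤-trans (c≤d j) (m≤n+m _ _)

-- Subtyping

-- What remains of a type when levels and capabilities are erased.  Subtypes
-- have the same shape, so meanings need no coercions.
data Shape : Set where
  𝕦  : Shape
  ch : ∀ {m} → Vec Shape m → Shape

shape  : Ty → Shape
shapes : ∀ {m} → Vec Ty m → Vec Shape m
shape (♯ k Ts) = ch (shapes Ts)
shape (𝕚 k Ts) = ch (shapes Ts)
shape (𝕠 k Ts) = ch (shapes Ts)
shape 𝕌        = 𝕦
shapes []       = []
shapes (T ∷ Ts) = shape T ∷ shapes Ts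

shape-≼  : ∀ {T U} → T ≼ U → shape T ≡ shape U
shapes-≼ : ∀ {m} {Ts Us : Vec Ty m} → Pointwise _≼_ Ts Us → shapes Ts ≡ shapes Us
shape-≼ ≼-refl        = refl
shape-≼ (≼-trans p q) = trans (shape-≼ p) (shape-≼ q)
shape-≼ ♯≼𝕚           = refl
shape-≼ ♯≼𝕠           = refl
shape-≼ (𝕚≼𝕚 p _)     = cong ch (shapes-≼ p)
shape-≼ (𝕠≼𝕠 p _)     = cong ch (sym (shapes-≼ p))
shapes-≼ []       = refl
shapes-≼ (p ∷ ps) = cong₂ _∷_ (shape-≼ p) (shapes-≼ ps)

-- Inversion of subtyping with transitivity eliminated. Starting from `♯` is enough, since the type
-- of every channel meaning has that form.
data Above {m} (k : ℕ) (Ts : Vec Ty m) : Ty → Set where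
  ♯ : Above k Ts (♯ k Ts)
  𝕚 : ∀ {i} {Us : Vec Ty m} → i ≤ k → Pointwise _≼_ Ts Us → Above k Ts (𝕚 i Us)
  𝕠 : ∀ {i} {Us : Vec Ty m} → k ≤ i → Pointwise _≼_ Us Ts → Above k Ts (𝕠 i Us)

above-≼ : ∀ {m k} {Ts : Vec Ty m} {T U} → Above k Ts T → T ≼ U → Above k Ts U
above-≼ h         ≼-refl        = h
above-≼ h         (≼-trans p q) = above-≼ (above-≼ h p) q
above-≼ ♯         ♯≼𝕚           = 𝕚 ≤-refl (Pointwise.refl ≼-refl)
above-≼ ♯         ♯≼𝕠           = 𝕠 ≤-refl (Pointwise.refl ≼-refl)
above-≼ (𝕚 le ps) (𝕚≼𝕚 qs le′)  = 𝕚 (≤-trans le′ le) (Pointwise.trans ≼-trans ps qs)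
above-≼ (𝕠 le ps) (𝕠≼𝕠 qs le′)  = 𝕠 (≤-trans le le′) (Pointwise.trans ≼-trans qs ps)

-- Meanings

Meaning : Shape → Set
Args    : ∀ {m} → Vec Shape m → Vec Ty m → Set
typeOf  : ∀ τ → Meaning τ → Ty

-- A channel has a level, parameter types and the cost of an output on it.
-- Recursion on shapes, since a channel also accepts arguments of subtypes.
Meaning 𝕦           = ⊤
Meaning (ch {m} τs) =
  Σ ℕ λ k → Σ (Vec Ty m) λ Ts → shapes Ts ≡ τs × (Args τs Ts → Fee k)

Args []       []       = ⊤
Args (τ ∷ τs) (T ∷ Ts) = (Σ (Meaning τ) λ s → typeOf τ s ≼ T) × Args τs Ts

typeOf 𝕦       _            = 𝕌
typeOf (ch τs) (k , Ts , _) = ♯ k Ts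

Sem : Set
Sem = Σ Shape Meaning

infix 4 _∈_ _∈*_
_∈_ : Sem → Ty → Set
(τ , s) ∈ T = typeOf τ s ≼ T

_∈*_ : ∀ {m m′} → Vec Sem m → Vec Ty m′ → Set
_∈*_ = Pointwise _∈_

shape-typeOf : ∀ τ s → shape (typeOf τ s) ≡ τ
shape-typeOf 𝕦       _                = refl
shape-typeOf (ch τs) (_ , _ , eq , _) = cong ch eq

sems : ∀ {m} (τs : Vec Shape m) Ts → Args τs Ts → Vec Sem m
sems []       []       _             = []
sems (τ ∷ τs) (T ∷ Ts) ((s , _) , u) = (τ , s) ∷ sems τs Ts u

sems-∈* : ∀ {m} (τs : Vec Shape m) Ts u → sems τs Ts u ∈* Ts
sems-∈* []       []       _             = []
sems-∈* (τ ∷ τs) (T ∷ Ts) ((_ , p) , u) = p ∷ sems-∈* τs Ts u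

args : ∀ {m} (Ts : Vec Ty m) {ss : Vec Sem m} → ss ∈* Ts →
       Σ (Args (shapes Ts) Ts) λ u → sems (shapes Ts) Ts u ≡ ss
args []       []                          = tt , refl
args (T ∷ Ts) (_∷_ {x = τ , s} p ps)
  -- A subtype has the shape of its supertype, so the shape carried by the given meaning is the one
  -- that `Args` prescribes.
  with trans (sym (shape-≼ p)) (shape-typeOf τ s) | args Ts ps
... | refl | u , refl = ((s , p) , u) , refl

-- The index `sems τs Ts u` makes a call carry the evidence that its arguments are accepted;
-- `call-𝕚` hands this evidence to the receiver.
data Call {m} : Sem → Vec Sem m → Cost → Set where
  call : ∀ {τs k Ts eq φ c} (u : Args τs Ts) → proj₁ (φ u) ≤̇ c →
         Call (ch τs , k , Ts , eq , φ) (sems τs Ts u) c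

call-mono : ∀ {m s} {ss : Vec Sem m} {c d} → c ≤̇ d → Call s ss c → Call s ss d
call-mono c≤d (call u le) = call u λ j → ≤-trans (le j) (c≤d j)

-- Contravariance of `𝕠` turns arguments in `Us` into accepted ones, and the true level is at most
-- `i`, which bounds the fee.
call-𝕠 : ∀ {m i} {Us : Vec Ty m} s {ss : Vec Sem m} → s ∈ 𝕠 i Us → ss ∈* Us →
         ∃ λ c → Bounded i c × Call s ss c
call-𝕠 (𝕦 , _) p _ = contradiction (shape-≼ p) λ ()
call-𝕠 (ch _ , k , Ts , refl , φ) p ps with above-≼ ♯ p
... | 𝕠 k≤i Us≼Ts with args Ts (Pointwise.trans ≼-trans ps Us≼Ts)
...   | u , refl =
  proj₁ (φ u) , bounded-mono k≤i (proj₂ (proj₂ (φ u))) , call u (λ _ → ≤-refl)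

call-𝕚 : ∀ {m i} {Us : Vec Ty m} {s} {ss : Vec Sem m} {c} → s ∈ 𝕚 i Us → Call s ss c →
         ss ∈* Us × ∃ λ k → i ≤ k × 1 ≤ c k
call-𝕚 {c = c} p (call {τs} {k} {Ts} {φ = φ} u le) with above-≼ ♯ p
... | 𝕚 i≤k Ts≼Us =
  Pointwise.trans ≼-trans (sems-∈* τs Ts u) Ts≼Us ,
  k , i≤k , ≤-trans (proj₁ (proj₂ (φ u))) (le k)

fun : ∀ {m} k (Ts : Vec Ty m) → (Args (shapes Ts) Ts → Σ Cost (Bounded k)) → Sem
fun k Ts b = ch (shapes Ts) , k , Ts , refl , λ u → δ+ k (b u)

-- No body cost is added: the unit at level `k` already exceeds every continuation of weight below
-- `k`.
imp : ∀ {m} → ℕ → Vec Ty m → Sem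
imp k Ts = fun k Ts λ _ → (λ _ → 0) , λ _ _ → refl

inhabitant : ∀ T → Σ Sem (_∈ T)
inhabitant (♯ k Ts) = imp k Ts , ≼-refl
inhabitant (𝕚 k Ts) = imp k Ts , ♯≼𝕚
inhabitant (𝕠 k Ts) = imp k Ts , ♯≼𝕠
inhabitant 𝕌        = (𝕦 , tt) , ≼-refl

-- Costs of processes

⟦_⟧ : ∀ {n} → Val n → Vec Sem n → Sem
⟦ ⋆      ⟧ ρ = 𝕦 , tt
⟦ name a ⟧ ρ = lookup ρ a

Answers : ∀ {m} → Sem → (Vec Sem m → Cost → Set) → Set
Answers {m} s Q = ∀ (ss : Vec Sem m) c → Call s ss c → ∃ λ d → d ≺ c × Q ss d

answers-⇔ : ∀ {m s} {Q Q′ : Vec Sem m → Cost → Set} →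
            (∀ ss c → Q ss c ⇔ Q′ ss c) → Answers s Q ⇔ Answers s Q′
answers-⇔ h = mk⇔
  (λ p ss c q → map₂ (map₂ (to   (h ss _))) (p ss c q))
  (λ p ss c q → map₂ (map₂ (from (h ss _))) (p ss c q))

infix 4 _⊩_∶_
-- Inputs put no demand on `c`, because their bodies are paid for by the outputs that trigger them.
-- For the same reason a replicated input is treated like a single one.
_⊩_∶_ : ∀ {n} → Vec Sem n → Proc n → Cost → Set
ρ ⊩ 𝟎         ∶ c = ⊤
ρ ⊩ P ∣ Q     ∶ c = ∃ λ d → ∃ λ e → ρ ⊩ P ∶ d × ρ ⊩ Q ∶ e × d +̇ e ≤̇ c
ρ ⊩ out a vs  ∶ c = Call (lookup ρ a) (map (λ v → ⟦ v ⟧ ρ) vs) c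
ρ ⊩ ν P       ∶ c = ∃ λ s → (s ∷ ρ) ⊩ P ∶ c
ρ ⊩ inp a P   ∶ c = Answers (lookup ρ a) λ ss d → (ss ++ ρ) ⊩ P ∶ d
ρ ⊩ rep a P   ∶ c = Answers (lookup ρ a) λ ss d → (ss ++ ρ) ⊩ P ∶ d

⊩-mono : ∀ {n} {ρ : Vec Sem n} P {c d} → c ≤̇ d → ρ ⊩ P ∶ c → ρ ⊩ P ∶ d
⊩-mono 𝟎         c≤d p = tt
⊩-mono (P ∣ Q)   c≤d (_ , _ , p , q , le) = _ , _ , p , q , λ j → ≤-trans (le j) (c≤d j)
⊩-mono (out a x) c≤d p = call-mono c≤d p
⊩-mono (ν P)     c≤d (s , p) = s , ⊩-mono P c≤d p
⊩-mono (inp a P) c≤d p = p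
⊩-mono (rep a P) c≤d p = p

lookup-lift : ∀ {m n n′} (ss : Vec Sem m) {ρ : Vec Sem n} {ρ′ : Vec Sem n′} r →
              (∀ a → lookup ρ′ (r a) ≡ lookup ρ a) →
              ∀ a → lookup (ss ++ ρ′) (lift m r a) ≡ lookup (ss ++ ρ) a
lookup-lift []       r h a       = h a
lookup-lift (s ∷ ss) r h zero    = refl
lookup-lift (s ∷ ss) r h (suc a) = lookup-lift ss r h a

⟦⟧-rename : ∀ {n n′} {ρ : Vec Sem n} {ρ′ : Vec Sem n′} r →
            (∀ a → lookup ρ′ (r a) ≡ lookup ρ a) →
            ∀ v → ⟦ renameVal r v ⟧ ρ′ ≡ ⟦ v ⟧ ρ
⟦⟧-rename r h ⋆        = refl
⟦⟧-rename r h (name a) = h a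

-- An equivalence, because scope extrusion, read from left to right, has to remove a weakening.
⊩-rename : ∀ {n n′} {ρ : Vec Sem n} {ρ′ : Vec Sem n′} r →
           (∀ a → lookup ρ′ (r a) ≡ lookup ρ a) →
           ∀ P {c} → ρ ⊩ P ∶ c ⇔ ρ′ ⊩ rename r P ∶ c
⊩-rename r h 𝟎 = mk⇔ _ _
⊩-rename r h (P ∣ Q) = mk⇔
  (λ (_ , _ , p , q , le) → _ , _ , to (⊩-rename r h P) p , to (⊩-rename r h Q) q , le)
  (λ (_ , _ , p , q , le) → _ , _ , from (⊩-rename r h P) p , from (⊩-rename r h Q) q , le)
⊩-rename {ρ = ρ} {ρ′} r h (out a vs) {c} =
  mk⇔ (≡.subst (λ (s , ss) → Call s ss c) (sym eq)) (≡.subst (λ (s , ss) → Call s ss c) eq)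
  where
  eq : (lookup ρ′ (r a) , map (λ v → ⟦ v ⟧ ρ′) (map (renameVal r) vs)) ≡
       (lookup ρ a , map (λ v → ⟦ v ⟧ ρ) vs)
  eq = cong₂ _,_ (h a) (trans (sym (map-∘ _ _ vs)) (map-cong (⟦⟧-rename r h) vs))
⊩-rename r h (ν P) = mk⇔ (map₂ (to ih)) (map₂ (from ih))
  where
  ih : ∀ {s c} → (s ∷ _) ⊩ P ∶ c ⇔ (s ∷ _) ⊩ rename (lift 1 r) P ∶ c
  ih {s} = ⊩-rename (lift 1 r) (lookup-lift (s ∷ []) r h) P
⊩-rename r h (inp {m} a P) rewrite h a =
  answers-⇔ λ ss c → ⊩-rename (lift (suc m) r) (lookup-lift ss r h) P
⊩-rename r h (rep {m} a P) rewrite h a =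
  answers-⇔ λ ss c → ⊩-rename (lift (suc m) r) (lookup-lift ss r h) P

⊩-weaken : ∀ {n} {ρ : Vec Sem n} {s} P {c} → ρ ⊩ P ∶ c ⇔ (s ∷ ρ) ⊩ weaken P ∶ c
⊩-weaken = ⊩-rename suc (λ _ → refl)

lookup-swap : ∀ {n} {ρ : Vec Sem n} {s t} a →
              lookup (s ∷ t ∷ ρ) (swap a) ≡ lookup (t ∷ s ∷ ρ) a
lookup-swap zero          = refl
lookup-swap (suc zero)    = refl
lookup-swap (suc (suc a)) = refl

⊩-≋ : ∀ {n} {ρ : Vec Sem n} {P Q c} → P ≋ Q → ρ ⊩ P ∶ c ⇔ ρ ⊩ Q ∶ c
⊩-≋ ≋-refl = mk⇔ (λ p → p) (λ p → p)
⊩-≋ (≋-sym h) = mk⇔ (from (⊩-≋ h)) (to (⊩-≋ h))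
⊩-≋ (≋-trans h h′) = mk⇔ (to (⊩-≋ h′) ∘ to (⊩-≋ h)) (from (⊩-≋ h) ∘ from (⊩-≋ h′))
⊩-≋ (∣-cong h h′) = mk⇔
  (λ (_ , _ , p , q , le) → _ , _ , to (⊩-≋ h) p , to (⊩-≋ h′) q , le)
  (λ (_ , _ , p , q , le) → _ , _ , from (⊩-≋ h) p , from (⊩-≋ h′) q , le)
⊩-≋ (ν-cong h) = mk⇔ (map₂ (to (⊩-≋ h))) (map₂ (from (⊩-≋ h)))
⊩-≋ (inp-cong h) = answers-⇔ λ _ _ → ⊩-≋ h
⊩-≋ (rep-cong h) = answers-⇔ λ _ _ → ⊩-≋ h
⊩-≋ ∣-assoc = mk⇔
  (λ { (c , _ , p , (d , e , q , r , le′) , le) →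
       _ , e , (c , d , p , q , λ _ → ≤-refl) , r , λ j →
       ≤-trans (≤-reflexive (+-assoc (c j) (d j) (e j)))
               (≤-trans (+-monoʳ-≤ (c j) (le′ j)) (le j)) })
  (λ { (_ , e , (c , d , p , q , le′) , r , le) →
       c , _ , p , (d , e , q , r , λ _ → ≤-refl) , λ j →
       ≤-trans (≤-reflexive (sym (+-assoc (c j) (d j) (e j))))
               (≤-trans (+-monoˡ-≤ (e j) (le′ j)) (le j)) })
⊩-≋ {ρ = ρ} ∣-comm = mk⇔ (flip _ _) (flip _ _)
  where
  flip : ∀ P Q {c} → ρ ⊩ P ∣ Q ∶ c → ρ ⊩ Q ∣ P ∶ c
  flip P Q (d , e , p , q , le) =
    e , d , q , p , λ j → ≤-trans (≤-reflexive (+-comm (e j) (d j))) (le j)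
⊩-≋ {Q = Q} ∣-unit = mk⇔
  (λ (d , e , p , _ , le) → ⊩-mono Q (λ j → ≤-trans (m≤m+n (d j) (e j)) (le j)) p)
  (λ p → _ , (λ _ → 0) , p , tt , λ _ → ≤-reflexive (+-identityʳ _))
⊩-≋ ν-𝟎 = mk⇔ _ (λ _ → (𝕦 , tt) , tt)
⊩-≋ (ν-swap {P}) = mk⇔
  (λ (s , t , p) → t , s , to (⊩-rename swap lookup-swap P) p)
  (λ (s , t , p) → t , s , from (⊩-rename swap lookup-swap P) p)
⊩-≋ (ν-extr {P}) = mk⇔
  (λ (s , _ , _ , p , q , le) → _ , _ , from (⊩-weaken P) p , (s , q) , le)
  (λ (_ , _ , p , (s , q) , le) → s , _ , _ , to (⊩-weaken P) p , q , le)

-- Substitution and reduction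

Realizes : ∀ {n n′} → Sub n n′ → Vec Sem n → Vec Sem n′ → Set
Realizes σ ρ ρ′ = ∀ a → ⟦ σ a ⟧ ρ′ ≡ lookup ρ a

realizes-lift : ∀ {m n n′} (ss : Vec Sem m) {ρ : Vec Sem n} {ρ′ : Vec Sem n′} {σ} →
                Realizes σ ρ ρ′ → Realizes (liftSub m σ) (ss ++ ρ) (ss ++ ρ′)
realizes-lift []       h a    = h a
realizes-lift (s ∷ ss) h zero = refl
realizes-lift {suc m} (s ∷ ss) {σ = σ} h (suc a) =
  trans (⟦⟧-rename suc (λ _ → refl) (liftSub m σ a)) (realizes-lift ss h a)

⟦⟧-subst : ∀ {n n′ σ} {ρ : Vec Sem n} {ρ′ : Vec Sem n′} → Realizes σ ρ ρ′ →
           ∀ v → ⟦ substVal σ v ⟧ ρ′ ≡ ⟦ v ⟧ ρ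
⟦⟧-subst h ⋆        = refl
⟦⟧-subst h (name a) = h a

answers-subst : ∀ {m s s′} {Q Q′ : Vec Sem m → Cost → Set} → s′ ≡ s →
                (∀ ss {c} → Q ss c → Q′ ss c) → Answers s Q → Answers s′ Q′
answers-subst refl h p ss c q = map₂ (map₂ (h ss)) (p ss c q)

-- Replacing a name by a value of equal meaning leaves all conditions intact. Success of the
-- substitution excludes `⋆` in subject position.
⊩-subst : ∀ {n n′ σ} {ρ : Vec Sem n} {ρ′ : Vec Sem n′} → Realizes σ ρ ρ′ →
          ∀ P {P′ c} → subst σ P ≡ just P′ → ρ ⊩ P ∶ c → ρ′ ⊩ P′ ∶ c
⊩-subst h 𝟎 refl p = tt
⊩-subst {σ = σ} h (P ∣ Q) eq (_ , _ , p , q , le)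
  with subst σ P in eqP | subst σ Q in eqQ
⊩-subst h (P ∣ Q) refl (_ , _ , p , q , le) | just _ | just _ =
  _ , _ , ⊩-subst h P eqP p , ⊩-subst h Q eqQ q , le
⊩-subst {σ = σ} h (out a vs) eq p with σ a | h a
⊩-subst {ρ′ = ρ′} h (out a vs) {c = c} refl p | name b | ha =
  ≡.subst (λ (s , ss) → Call s ss c)
    (cong₂ _,_ (sym ha) (sym (trans (sym (map-∘ _ _ vs)) (map-cong (⟦⟧-subst h) vs)))) p
⊩-subst {σ = σ} h (ν P) eq (s , p) with subst (liftSub 1 σ) P in eqP
⊩-subst h (ν P) refl (s , p) | just _ = s , ⊩-subst (realizes-lift (s ∷ []) h) P eqP p
⊩-subst {σ = σ} h (inp {m} a P) eq p
  with σ a | h a | subst (liftSub (suc m) σ) P in eqP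
⊩-subst h (inp a P) refl p | name b | ha | just _ =
  answers-subst ha (λ ss → ⊩-subst (realizes-lift ss h) P eqP) p
⊩-subst {σ = σ} h (rep {m} a P) eq p
  with σ a | h a | subst (liftSub (suc m) σ) P in eqP
⊩-subst h (rep a P) refl p | name b | ha | just _ =
  answers-subst ha (λ ss → ⊩-subst (realizes-lift ss h) P eqP) p

realizes-args : ∀ {m n} (ρ : Vec Sem n) (vs : Vec (Val n) m) →
                Realizes ([ lookup vs , name ]′ ∘ splitAt m) (map (λ v → ⟦ v ⟧ ρ) vs ++ ρ) ρ
realizes-args ρ []       a       = refl
realizes-args ρ (v ∷ vs) zero    = refl
realizes-args {suc m} ρ (v ∷ vs) (suc a) with splitAt m a | realizes-args ρ vs a
... | inj₁ _ | eq = eq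
... | inj₂ _ | eq = eq

⊩-[] : ∀ {m n} {ρ : Vec Sem n} (P : Proc (m + n)) {vs P′ c} → P [ vs ] ≡ just P′ →
       (map (λ v → ⟦ v ⟧ ρ) vs ++ ρ) ⊩ P ∶ c → ρ ⊩ P′ ∶ c
⊩-[] {ρ = ρ} P {vs} = ⊩-subst (realizes-args ρ vs) P

⊩-⟶ : ∀ {n} {ρ : Vec Sem n} {P Q c} → P ⟶ Q → ρ ⊩ P ∶ c → ∃ λ d → d ≺ c × ρ ⊩ Q ∶ d
⊩-⟶ (comm {P = P} eq) (c , e , p , q , le) with p _ _ q
... | d , d≺e , r = d , ≺-≤̇-trans d≺e (λ j → ≤-trans (m≤n+m (e j) (c j)) (le j)) , ⊩-[] P eq r
⊩-⟶ (call {P = P} eq) (c , e , p , q , le) with p _ _ q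
... | d , d≺e , r =
  -- The replicated input stays and keeps its share `c`; the body's `d` replaces the share `e` of
  -- the consumed output.
  c +̇ d , ≺-≤̇-trans (+̇-monoʳ-≺ c d≺e) le , c , d , p , ⊩-[] P eq r , λ _ → ≤-refl
⊩-⟶ (par h) (c , e , p , q , le) with ⊩-⟶ h p
... | d , d≺c , p′ =
  d +̇ e , ≺-≤̇-trans (+̇-monoˡ-≺ e d≺c) le , d , e , p′ , q , λ _ → ≤-refl
⊩-⟶ (res h) (s , p) with ⊩-⟶ h p
... | d , d≺c , p′ = d , d≺c , s , p′
⊩-⟶ (struct h red h′) p = map₂ (map₂ (to (⊩-≋ h′))) (⊩-⟶ red (to (⊩-≋ h) p))

⊩-terminates : ∀ {n} {ρ : Vec Sem n} {P c w} → Bounded w c → ρ ⊩ P ∶ c → Terminates P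
⊩-terminates {ρ = ρ} {c = c} {w} b p (Ps , refl , reds) =
  -- By `≺-bounded` the initial bound `w` holds along the whole reduction sequence, so one
  -- well-founded order serves for all steps.
  go (≺[]-wellFounded (suc w) c) b 0 p
  where
  go : ∀ {c} → Acc _≺[ suc w ]_ c → Bounded w c → ∀ i → ρ ⊩ Ps i ∶ c → ⊥
  go (acc r) b i p with ⊩-⟶ (reds i) p
  ... | d , d≺c , p′ = go (r (≺⇒≺[] b d≺c)) (≺-bounded d≺c b) (suc i) p′

-- Meanings of the names of a typing context

Slot : Maybe Ty → Set
Slot nothing  = ⊤
Slot (just T) = Σ Sem (_∈ T)

Env : ∀ {n} → Ctx n → Set
Env = All Slot

Fits : ∀ t → Slot t → Sem → Set
Fits nothing  _       s = ⊤
Fits (just T) (s′ , _) s = s ≡ s′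

infix 4 _≈_
-- At names outside the domain of `Γ`, in particular at an isolated name, `ρ` is unconstrained.
data _≈_ : ∀ {n} {Γ : Ctx n} → Env Γ → Vec Sem n → Set where
  []  : [] ≈ []
  _∷_ : ∀ {n t g s} {Γ : Ctx n} {E : Env Γ} {ρ} →
        Fits t g s → E ≈ ρ → _≈_ {Γ = t ∷ Γ} (g ∷ E) (s ∷ ρ)

slot : ∀ {n} {Γ : Ctx n} → Env Γ → ∀ a → Slot (lookup Γ a)
slot (g ∷ E) zero    = g
slot (g ∷ E) (suc a) = slot E a

slot-fits : ∀ {n} {Γ : Ctx n} {E : Env Γ} {ρ} → E ≈ ρ →
            ∀ a → Fits (lookup Γ a) (slot E a) (lookup ρ a)
slot-fits (p ∷ ps) zero    = p
slot-fits (p ∷ ps) (suc a) = slot-fits ps a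

fits-subst : ∀ {t T g s} (eq : t ≡ just T) → Fits t g s → s ≡ proj₁ (≡.subst Slot eq g)
fits-subst refl p = p

eval : ∀ {n} {Γ : Ctx n} {v T} → Env Γ → Γ ⊢ᵛ v ∶ T → Σ Sem (_∈ T)
eval E unit          = (𝕦 , tt) , ≼-refl
eval E (var {a} eq)  = ≡.subst Slot eq (slot E a)
eval E (sub d T≼U)   = map₂ (λ p → ≼-trans p T≼U) (eval E d)

⟦⟧-eval : ∀ {n} {Γ : Ctx n} {E : Env Γ} {ρ v T} → E ≈ ρ → (d : Γ ⊢ᵛ v ∶ T) →
          ⟦ v ⟧ ρ ≡ proj₁ (eval E d)
⟦⟧-eval E≈ρ unit         = refl
⟦⟧-eval E≈ρ (var {a} eq) = fits-subst eq (slot-fits E≈ρ a)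
⟦⟧-eval E≈ρ (sub d _)    = ⟦⟧-eval E≈ρ d

evals : ∀ {n m} {Γ : Ctx n} {vs : Vec (Val n) m} {Ts : Vec Ty m} → Env Γ → Pointwise (Γ ⊢ᵛ_∶_) vs Ts →
        Σ (Vec Sem m) (_∈* Ts)
evals E []       = [] , []
evals E (d ∷ ds) with eval E d | evals E ds
... | s , p | ss , ps = s ∷ ss , p ∷ ps

⟦⟧-evals : ∀ {n m} {Γ : Ctx n} {E : Env Γ} {ρ} {vs : Vec (Val n) m} {Ts : Vec Ty m} → E ≈ ρ →
           (ds : Pointwise (Γ ⊢ᵛ_∶_) vs Ts) → map (λ v → ⟦ v ⟧ ρ) vs ≡ proj₁ (evals E ds)
⟦⟧-evals E≈ρ []       = refl
⟦⟧-evals E≈ρ (d ∷ ds) = cong₂ _∷_ (⟦⟧-eval E≈ρ d) (⟦⟧-evals E≈ρ ds)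

extendEnv : ∀ {n m} {Γ : Ctx n} {ss : Vec Sem m} {Ts : Vec Ty m} → ss ∈* Ts → Env Γ → Env (Γ ,* Ts)
extendEnv []                 E = E
extendEnv (_∷_ {x = s} p ps) E = (s , p) ∷ extendEnv ps E

extendEnv-≈ : ∀ {n m} {Γ : Ctx n} {ss : Vec Sem m} {Ts : Vec Ty m} (ps : ss ∈* Ts)
              {E : Env Γ} {ρ} → E ≈ ρ → extendEnv ps E ≈ ss ++ ρ
extendEnv-≈ []       E≈ρ = E≈ρ
extendEnv-≈ (p ∷ ps) E≈ρ = refl ∷ extendEnv-≈ ps E≈ρ

update : ∀ {n} {Γ : Ctx n} {T} → Env Γ → ∀ f → Σ Sem (_∈ T) → Env (Γ , f ∶ T)
update (_ ∷ E) zero    g = g ∷ E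
update (h ∷ E) (suc f) g = h ∷ update E f g

update-lookup : ∀ {n} {Γ : Ctx n} {T} (E : Env Γ) f {g : Σ Sem (_∈ T)} {ρ} →
                update E f g ≈ ρ → lookup ρ f ≡ proj₁ g
update-lookup (_ ∷ E) zero    (p ∷ _)  = p
update-lookup (_ ∷ E) (suc f) (_ ∷ ps) = update-lookup E f ps

update-forget : ∀ {n} {Γ : Ctx n} {T} (E : Env Γ) {f} {g : Σ Sem (_∈ T)} {ρ} → f ∉dom Γ →
                update E f g ≈ ρ → E ≈ ρ
update-forget {Γ = nothing ∷ Γ} (_ ∷ E) {zero}  f∉ (_ ∷ ps) = tt ∷ ps
update-forget                   (_ ∷ E) {suc f} f∉ (p ∷ ps) = p ∷ update-forget E f∉ ps

inhabitants : ∀ {n} (Γ : Ctx n) → Env Γ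
inhabitants []             = []
inhabitants (nothing ∷ Γ)  = tt ∷ inhabitants Γ
inhabitants (just T ∷ Γ)   = inhabitant T ∷ inhabitants Γ

realize : ∀ {n} {Γ : Ctx n} (E : Env Γ) → ∃ (E ≈_)
realize []                        = [] , []
realize (_∷_ {x = nothing} _ E)   = let ρ , p = realize E in (𝕦 , tt) ∷ ρ , tt ∷ p
realize (_∷_ {x = just T} (s , _) E) = let ρ , p = realize E in s ∷ ρ , refl ∷ p

-- Soundness of typing

-- The cost is chosen before `ρ`, hence independently of the meaning of an isolated name. This lets
-- the bodies of that name be costed before its meaning exists.
Sound : ∀ {n} {Γ : Ctx n} → Env Γ → Proc n → ℕ → Set
Sound E P w = ∃ λ c → Bounded w c × ∀ {ρ} → E ≈ ρ → ρ ⊩ P ∶ c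

isolated : ∀ {l} k (Ts : Vec Ty l) → (Args (shapes Ts) Ts → Σ Cost (Bounded k)) → Σ Sem (_∈ 𝕠 k Ts)
isolated k Ts b = fun k Ts b , ♯≼𝕠

-- The caller has paid at least one unit at some level no lower than `i`, and the body has weight
-- below `i`, so `bounded-≺` applies.
answers-𝕚 : ∀ {n m i w} {Γ : Ctx n} {E : Env Γ} {ρ} {Us : Vec Ty m} {P : Proc (m + n)} {s} →
            s ∈ 𝕚 i Us → w < i → (∀ {ss} (ps : ss ∈* Us) → Sound (extendEnv ps E) P w) → E ≈ ρ →
            Answers {m} s λ ss d → (ss ++ ρ) ⊩ P ∶ d
answers-𝕚 p w<i h E≈ρ ss c q with call-𝕚 p q
... | ps , k , i≤k , 1≤ck with h ps
...   | d , b , r = d , bounded-≺ b (<-≤-trans w<i i≤k) 1≤ck , r (extendEnv-≈ ps E≈ρ)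

answers-fun : ∀ {m k s} {Ts : Vec Ty m} {b Q} → s ≡ fun k Ts b →
              (∀ u → ∃ λ d → d ≤̇ proj₁ (b u) × Q (sems (shapes Ts) Ts u) d) → Answers s Q
answers-fun {b = b} refl h _ c (call u fee≤c) =
  let d , d≤b , q = h u in d , ≺-≤̇-trans (≺-δ+ (b u) d≤b) fee≤c , q

-- The body cost that goes into the meaning of `f`, computed from `E` alone, where `f` has no
-- meaning yet.
bodies : ∀ {n l} {Γ : Ctx n} {f k} {Ts : Vec Ty l} {P w} → Γ • f ∶𝕠^ k ⟨ Ts ⟩⊢ P ∶ w → Env Γ →
         Args (shapes Ts) Ts → Σ Cost (Bounded k)

-- Asking `b` only to dominate the bodies lets both sides of a parallel composition share one
-- meaning of `f`.
sound : ∀ {n l} {Γ : Ctx n} {f k} {Ts : Vec Ty l} {P w} (D : Γ • f ∶𝕠^ k ⟨ Ts ⟩⊢ P ∶ w) (E : Env Γ) →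
        f ∉dom Γ → ∀ b → (∀ u → proj₁ (bodies D E u) ≤̇ proj₁ (b u)) →
        Sound (update E f (isolated k Ts b)) P w

sound⁻ : ∀ {n} {Γ : Ctx n} {P w} → Γ •-⊢ P ∶ w → (E : Env Γ) → Sound E P w

bodies {Ts = Ts} (rep-fun D k≥w) E u =
  let c , b , _ = sound⁻ D (extendEnv (sems-∈* (shapes Ts) Ts u) E) in c , bounded-mono k≥w b
-- A call on `f` may be answered by an input on either side; the sum dominates both.
bodies (par D D′)    E u =
  let c , b = bodies D E u ; c′ , b′ = bodies D′ E u in c +̇ c′ , bounded-+̇ b b′
bodies (res-imp {i = i} {Us} D) E u = bodies D ((imp i Us , ≼-refl) ∷ E) u
-- Nothing to count in the remaining cases: under a prefix or a functional restriction `f` has only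
-- the output capability, so no input on it can occur there.
bodies nil               E u = (λ _ → 0) , λ _ _ → refl
bodies (out _ _)         E u = (λ _ → 0) , λ _ _ → refl
bodies (inp-imp _ _ _)   E u = (λ _ → 0) , λ _ _ → refl
bodies (rep-imp _ _ _)   E u = (λ _ → 0) , λ _ _ → refl
bodies (res-fun _)       E u = (λ _ → 0) , λ _ _ → refl

sound nil E f∉ b le = (λ _ → 0) , (λ _ _ → refl) , λ _ → tt
sound {f = f} {k} {Ts} (rep-fun {P = P} D k≥w) E f∉ b le =
  (λ _ → 0) , (λ _ _ → refl) , λ E≈ρ →
  answers-fun (update-lookup E f E≈ρ) λ u →
  let ps = sems-∈* (shapes Ts) Ts u
      d , _ , r = sound⁻ D (extendEnv ps E)
  -- The body is typed without `f`, so it is evaluated in `E` and the entry for `f` is forgotten.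
  in d , le u , r (extendEnv-≈ ps (update-forget E f∉ E≈ρ))
sound {f = f} (out d ds) E f∉ b le with call-𝕠 _ (proj₂ (eval E′ d)) (proj₂ (evals E′ ds))
  where E′ = update E f (isolated _ _ b)
... | c , bd , q = c , bd , λ E≈ρ →
  ≡.subst (λ (s , ss) → Call s ss c) (sym (cong₂ _,_ (⟦⟧-eval E≈ρ d) (⟦⟧-evals E≈ρ ds))) q
sound (inp-imp {i = i} {Us} d D i>w) E f∉ b le =
  (λ _ → 0) , (λ _ _ → refl) , λ E≈ρ →
  answers-𝕚 (≡.subst (_∈ 𝕚 i Us) (sym (⟦⟧-eval (update-forget E f∉ E≈ρ) d)) (proj₂ (eval E d)))
    i>w (λ ps → sound⁻ D (extendEnv ps (update E _ (isolated _ _ b)))) E≈ρ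
sound (rep-imp {i = i} {Us} d D i>w) E f∉ b le =
  (λ _ → 0) , (λ _ _ → refl) , λ E≈ρ →
  answers-𝕚 (≡.subst (_∈ 𝕚 i Us) (sym (⟦⟧-eval (update-forget E f∉ E≈ρ) d)) (proj₂ (eval E d)))
    i>w (λ ps → sound⁻ D (extendEnv ps (update E _ (isolated _ _ b)))) E≈ρ
sound (par {w₁ = w₁} {w₂} D D′) E f∉ b le
  with sound D  E f∉ b (λ u j → m+n≤o⇒m≤o _ (le u j))
     | sound D′ E f∉ b (λ u j → m+n≤o⇒n≤o (proj₁ (bodies D E u) j) (le u j))
... | c , bd , p | c′ , bd′ , p′ =
  c +̇ c′ , bounded-+̇ (bounded-mono (m≤m⊔n w₁ w₂) bd) (bounded-mono (m≤n⊔m w₁ w₂) bd′) ,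
  λ E≈ρ → c , c′ , p E≈ρ , p′ E≈ρ , λ _ → ≤-refl
sound {f = f} (res-fun D) E f∉ b le
  -- The outer `f` now has a fixed meaning, so the bodies of the new isolated name may call it; the
  -- new name itself still has an empty slot.
  with sound D (tt ∷ update E f (isolated _ _ b)) refl (bodies D _) (λ _ _ → ≤-refl)
... | c , bd , p = c , bd , λ E≈ρ → _ , p (refl ∷ E≈ρ)
sound (res-imp D) E f∉ b le with sound D _ f∉ b le
... | c , bd , p = c , bd , λ E≈ρ → _ , p (refl ∷ E≈ρ)

sound⁻ {P = P} (dummy D) E with sound D (tt ∷ E) refl (bodies D _) (λ _ _ → ≤-refl)
... | c , bd , p = c , bd , λ E≈ρ → from (⊩-weaken P) (p (refl ∷ E≈ρ))

theorem20 : ∀ {n m} (Γ : Ctx n) (f : Fin n) (k : ℕ) (Ts : Vec Ty m) (P : Proc n) (w : ℕ) →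
    f ∉dom Γ → Γ • f ∶𝕠^ k ⟨ Ts ⟩⊢ P ∶ w → Terminates P
theorem20 Γ f k Ts P w f∉ D
  -- Free names receive arbitrary meanings of their types, and `f` the one computed from its own
  -- bodies.
  with sound D (inhabitants Γ) f∉ (bodies D (inhabitants Γ)) (λ _ _ → ≤-refl)
... | c , bd , p = ⊩-terminates bd (p (proj₂ (realize _)))
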